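{- Let $r\ge 3$. For every sufficiently large $n$ there exists an $r$-uniform $r$-partite linear hypergraph $\mathcal{H}$ on $n$ vertices with $|\mathcal{H}|>n^{2-o(1)}$ edges (the $o(1)$ term tending to $0$ as $n\to\infty$) which contains no rainbow cycles of length three or four.
   Context: A hypergraph is linear if any two distinct edges share at most one vertex. An $r$-uniform hypergraph is $r$-partite if its vertex set is partitioned into $r$ parts $V_1,\dots,V_r$ such that every edge contains exactly one vertex of each part. A cycle of length $k$ in a hypergraph is a sequence $v_1,A_1,v_2,A_2,\dots,v_k,A_k,v_1$ where $v_1,\dots,v_k$ are distinct vertices, $A_1,\dots,A_k$ are distinct edges, $v_i,v_{i+1}\in A_i$ for $1\le i\le k-1$ and $v_k,v_1\in A_k$. In an $r$-uniform $r$-partite linear hypergraph such a cycle is a rainbow $k$-cycle if $v_1,\dots,v_k$ lie in $k$ pairwise different parts. -}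

module Defs where

open import Data.Nat as ℕ using (ℕ; zero; suc; _<?_)
open import Data.Fin using (Fin; zero; suc; toℕ; fromℕ<)
open import Data.Vec using (Vec; lookup)
open import Data.List using (List; length)
import Data.List as List
open import Data.List.Relation.Unary.All using (All)
open import Data.List.Relation.Unary.Unique.Propositional using (Unique)
open import Data.Product using (Σ; ∃; ∃-syntax; _×_; _,_)
open import Function.Definitions using (Injective)
open import Relation.Binary.PropositionalEquality using (_≡_; _≢_)
open import Relation.Nullary using (yes; no)

-- An r-uniform r-partite hypergraph on the vertex set Fin n.
-- `part v` is the part containing vertex v.  An edge is stored as the vector
-- of its vertices, the i-th entry being its (unique) vertex in part i; this is
-- a faithful encoding of an edge as a vertex set meeting each part exactly once.
record Hypergraph (r n : ℕ) : Set where
  field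
    part    : Fin n → Fin r
    edges   : List (Vec (Fin n) r)
    partite : All (λ e → (i : Fin r) → part (lookup e i) ≡ i) edges
    distinct : Unique edges

  Edge : Set
  Edge = Fin (length edges)

  edge : Edge → Vec (Fin n) r
  edge a = List.lookup edges a

  _∈E_ : Fin n → Edge → Set
  v ∈E a = ∃[ i ] lookup (edge a) i ≡ v

open Hypergraph public

numEdges : ∀ {r n} → Hypergraph r n → ℕ
numEdges H = length (edges H)

Linear : ∀ {r n} → Hypergraph r n → Set
Linear {r} {n} H = (a b : Edge H) → a ≢ b → (u w : Fin n) →
  _∈E_ H u a → _∈E_ H u b → _∈E_ H w a → _∈E_ H w b → u ≡ w

cyc : ∀ {m} → Fin (suc m) → Fin (suc m)
cyc {m} i with toℕ i <? m
... | yes p = suc (fromℕ< p)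
... | no _  = zero

-- A rainbow cycle of length k = suc m: v_0,A_0,v_1,A_1,...,v_m,A_m,v_0 with
-- distinct vertices, distinct edges, v_i, v_{i+1 mod k} ∈ A_i, and the
-- vertices in pairwise different parts.
RainbowCycle : ∀ {r n} → Hypergraph r n → (m : ℕ) → Set
RainbowCycle {r} {n} H m =
  Σ (Fin (suc m) → Fin n) λ v →
  Σ (Fin (suc m) → Edge H) λ A →
    Injective _≡_ _≡_ v ×
    Injective _≡_ _≡_ A ×
    ((i : Fin (suc m)) → _∈E_ H (v i) (A i) × _∈E_ H (v (cyc i)) (A i)) ×
    Injective _≡_ _≡_ (λ i → part H (v i))

{-# OPTIONS --safe #-}

-- Work in the ring ℤ[z₀, …, z_{r-1}].  An edge is a pair (x, d) of t-tuples of
-- polynomials with coefficients in [0, K), where x has degree at most T and d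
-- has degree less than T in each variable; its vertex in part p is x + z_p d.
-- A large fraction of the directions d share the same value of
-- ‖d‖² = Σⱼ dⱼ² at finitely many chosen evaluation points.  Given a rainbow
-- cycle through parts p₀, …, p_m, evaluate at a point with
-- z_{p₀} ≪ z_{p₁} ≪ … ≪ z_{p_m}.  Eliminating the positions x leaves
--   Σ_{i<m} (z_{p_{i+1}} − z_{p_i}) dᵢ = (z_{p_m} − z_{p₀}) d_m,
-- so d_m is a convex combination of the dᵢ, all lying on one sphere, and hence
-- all directions coincide.  Passing to several variables is what allows every
-- cyclic order of the parts to become monotone at some evaluation point.  For
-- T and t large and K → ∞ the number of edges is n^{2 − 1/k} or more, because
-- the grid [0, T)^r fills almost all of [0, T]^r and the number of norms is a
-- power of K independent of t.

module Submission where

open import Defs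
open import Data.Bool using (if_then_else_; true; false)
open import Data.Empty using (⊥-elim)
open import Data.Fin
  using (Fin; zero; suc; toℕ; fromℕ; fromℕ<; inject₁; inject≤; cast; punchIn; combine; remQuot
        ; finToFun; funToFin; _≟_)
open import Data.Fin.Properties
  using (toℕ-injective; toℕ<n; toℕ-fromℕ; toℕ-fromℕ<; toℕ-inject₁; toℕ-inject≤; toℕ-cast
        ; toℕ-combine; inject≤-injective; cast-involutive; punchInᵢ≢i; combine-injectiveˡ
        ; combine-injectiveʳ; combine-monoˡ-<; combine-remQuot; finToFun-funToFin
        ; funToFin-finToFin; any?)
open import Data.Integer as ℤ using (ℤ; 0ℤ; ∣_∣)
open import Data.Integer.Divisibility.Signed
  using (_∣_; divides; ∣n⇒∣m*n; ∣m∣n⇒∣m+n; ∣m+n∣n⇒∣m; *-cancelʳ-∣; ∣⇒∣ᵤ)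
import Data.Integer.Properties as ℤ
import Data.Integer.Tactic.RingSolver as ℤ-Solver
open import Data.List as List using (List; []; _∷_; length; filter)
open import Data.List.Membership.Propositional.Properties using (∈-lookup)
open import Data.List.Properties using (length-tabulate; lookup-tabulate)
open import Data.List.Relation.Unary.All as All using (All; []; _∷_)
import Data.List.Relation.Unary.All.Properties as All
open import Data.List.Relation.Unary.AllPairs using ([]; _∷_)
open import Data.List.Relation.Unary.Unique.Propositional using (Unique)
import Data.List.Relation.Unary.Unique.Propositional.Properties as Unique
open import Data.Nat as ℕ hiding (_≟_)
open import Data.Nat.Divisibility using (>⇒∤) renaming (_∣_ to _∣ℕ_)
open import Data.Nat.DivMod using (_mod_; [m+kn]%n≡m%n; m<n⇒m%n≡m)
open import Data.Nat.Properties hiding (_≟_)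
open import Data.Nat.Tactic.RingSolver using (solve-∀)
open import Data.Product using (Σ; ∃-syntax; _×_; _,_; proj₁; proj₂; uncurry)
open import Data.Sum using (inj₁; inj₂)
open import Data.Vec as Vec using (Vec; lookup)
open import Data.Vec.Functional using (removeAt)
open import Data.Vec.Properties using (lookup∘tabulate)
open import Function using (_∘_; id)
open import Function.Definitions using (Injective)
open import Relation.Binary.Definitions using (tri<; tri≈; tri>)
open import Relation.Binary.PropositionalEquality hiding (J)
open import Relation.Nullary
open import Relation.Nullary.Decidable using (¬?)
open import Algebra.Properties.Semiring.Sum +-*-semiring
  using (sum; ∑-distrib-+; ∑-comm; *-distribˡ-sum; *-distribʳ-sum; sum-cong-≗; sum-replicate-zero)
open import Algebra.Properties.Semiring.Sum ℤ.+-*-semiring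
  using () renaming (sum to sumℤ; sum-remove to sumℤ-remove)

-- Uniqueness of base-W expansions

∣-sum : ∀ {m} d (a : Fin m → ℤ) → (∀ k → d ∣ a k) → d ∣ sumℤ a
∣-sum {zero}  d a d∣a = divides 0ℤ refl
∣-sum {suc m} d a d∣a = ∣m∣n⇒∣m+n (d∣a zero) (∣-sum d (a ∘ suc) (d∣a ∘ suc))

∣-isolated-term : ∀ {m} d (a : Fin m → ℤ) i →
  (∀ k → k ≢ i → d ∣ a k) → d ∣ sumℤ a → d ∣ a i
∣-isolated-term {suc m} d a i d∣a d∣sum =
  ∣m+n∣n⇒∣m (subst (d ∣_) (sumℤ-remove {i = i} a) d∣sum)
    (∣-sum d (removeAt a i) (λ k → d∣a (punchIn i k) (punchInᵢ≢i i k)))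

sumℤ-difference : ∀ {m} (f g w : Fin m → ℕ) →
  sumℤ (λ i → (ℤ.+ f i ℤ.- ℤ.+ g i) ℤ.* ℤ.+ w i) ≡
  ℤ.+ sum (λ i → f i * w i) ℤ.- ℤ.+ sum (λ i → g i * w i)
sumℤ-difference {zero}  f g w = refl
sumℤ-difference {suc m} f g w
  rewrite sumℤ-difference (f ∘ suc) (g ∘ suc) (w ∘ suc) =
  trans (regroup (ℤ.+ f zero) (ℤ.+ g zero) (ℤ.+ w zero) (ℤ.+ sum (λ i → f (suc i) * w (suc i))) _)
    (sym (cong₂ (λ x y → x ℤ.+ ℤ.+ sum (λ i → f (suc i) * w (suc i))
                   ℤ.- (y ℤ.+ ℤ.+ sum (λ i → g (suc i) * w (suc i))))
           (ℤ.pos-* (f zero) (w zero)) (ℤ.pos-* (g zero) (w zero))))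
  where
  regroup : ∀ a b c x y →
    (a ℤ.- b) ℤ.* c ℤ.+ (x ℤ.- y) ≡ a ℤ.* c ℤ.+ x ℤ.- (b ℤ.* c ℤ.+ y)
  regroup = ℤ-Solver.solve-∀

∣∧<⇒≡0 : ∀ {d x} → d ∣ℕ x → x < d → x ≡ 0
∣∧<⇒≡0 {x = zero}  _   _   = refl
∣∧<⇒≡0 {x = suc x} d∣x x<d = ⊥-elim (>⇒∤ x<d d∣x)

-- At the smallest exponent where the digits differ, the difference of the two
-- sums is divisible by one power of W too few.
digits-unique : ∀ {m} W (ρ : Fin m → ℕ) → Injective _≡_ _≡_ ρ →
  (f g : Fin m → ℕ) → (∀ i → f i < W) → (∀ i → g i < W) →
  sum (λ i → f i * W ^ ρ i) ≡ sum (λ i → g i * W ^ ρ i) → ∀ i → f i ≡ g i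
digits-unique {m} W ρ ρ-inj f g f<W g<W eq i = below (suc (ρ i)) i (n<1+n _)
  where
  a : Fin m → ℤ
  a k = (ℤ.+ f k ℤ.- ℤ.+ g k) ℤ.* ℤ.+ (W ^ ρ k)

  sum-a≡0 : sumℤ a ≡ 0ℤ
  sum-a≡0 = trans (sumℤ-difference f g (λ k → W ^ ρ k)) (ℤ.i≡j⇒i-j≡0 (cong ℤ.+_ eq))

  instance
    W≢0 : NonZero W
    W≢0 = >-nonZero (≤-trans (s≤s z≤n) (f<W i))

  -- Strong induction on the exponent, with `n` as its strict upper bound.
  below : ∀ n j → ρ j < n → f j ≡ g j
  below (suc n) j (s≤s ρj≤n) =
    ℤ.+-injective (ℤ.i-j≡0⇒i≡j (ℤ.+ f j) (ℤ.+ g j) (ℤ.∣i∣≡0⇒i≡0 (∣∧<⇒≡0 (∣⇒∣ᵤ W∣h) ∣h∣<W)))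
    where
    instance
      W^≢0 : NonZero (W ^ ρ j)
      W^≢0 = m^n≢0 W (ρ j)

    -- Terms of smaller exponent vanish by induction; terms of larger exponent carry the extra
    -- factor `W`.
    others : ∀ k → k ≢ j → ℤ.+ (W ^ suc (ρ j)) ∣ a k
    others k k≢j with <-cmp (ρ k) (ρ j)
    ... | tri< ρk<ρj _ _ rewrite below n k (≤-trans ρk<ρj ρj≤n) | ℤ.i≡j⇒i-j≡0 {ℤ.+ g k} refl =
      divides 0ℤ refl
    ... | tri≈ _ ρk≡ρj _ = ⊥-elim (k≢j (ρ-inj ρk≡ρj))
    ... | tri> _ _ ρj<ρk = ∣n⇒∣m*n (ℤ.+ f k ℤ.- ℤ.+ g k)
      (divides (ℤ.+ (W ^ (ρ k ∸ suc (ρ j)))) (trans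
        (cong ℤ.+_ (trans (cong (W ^_) (sym (m∸n+n≡m ρj<ρk)))
          (^-distribˡ-+-* W (ρ k ∸ suc (ρ j)) (suc (ρ j)))))
        (ℤ.pos-* (W ^ (ρ k ∸ suc (ρ j))) _)))

    W∣h : ℤ.+ W ∣ (ℤ.+ f j ℤ.- ℤ.+ g j)
    W∣h = *-cancelʳ-∣ (ℤ.+ (W ^ ρ j))
      (subst (_∣ a j) (ℤ.pos-* W (W ^ ρ j))
        (∣-isolated-term _ a j others (divides 0ℤ sum-a≡0)))

    ∣h∣<W : ∣ ℤ.+ f j ℤ.- ℤ.+ g j ∣ < W
    ∣h∣<W rewrite ℤ.m-n≡m⊖n (f j) (g j) =
      ≤-<-trans (ℤ.∣m⊝n∣≤m⊔n (f j) (g j)) (⊔-pres-<m (f<W j) (g<W j))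

-- Strict convexity of the sphere

dot : ∀ {t} (u v : Fin t → ℕ) → ℕ
dot u v = sum (λ j → u j * v j)

dot-linear : ∀ {t} (x u w : Fin t → ℕ) c →
  dot (λ j → x j + c * u j) w ≡ dot x w + c * dot u w
dot-linear x u w c = begin
  sum (λ j → (x j + c * u j) * w j)
    ≡⟨ sum-cong-≗ (λ j → expand (x j) c (u j) (w j)) ⟩
  sum (λ j → x j * w j + c * (u j * w j))
    ≡⟨ ∑-distrib-+ (λ j → x j * w j) (λ j → c * (u j * w j)) ⟩
  dot x w + sum (λ j → c * (u j * w j))
    ≡⟨ cong (dot x w +_) (*-distribˡ-sum c (λ j → u j * w j)) ⟨
  dot x w + c * dot u w ∎
  where
  open ≡-Reasoning
  expand : ∀ x c u w → (x + c * u) * w ≡ x * w + c * (u * w)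
  expand = solve-∀

-- The defect is (m - n)². Splitting on the order of `m` and `n` keeps it a square in ℕ.
square-defect : ∀ m n → ∃[ d ] (m * n + m * n + d ≡ m * m + n * n × (d ≡ 0 → m ≡ n))
square-defect m n with ≤-total m n
... | inj₁ m≤n with e , refl ← m≤n⇒∃[o]m+o≡n m≤n =
  e * e , identity m e , λ e²≡0 → trans (sym (+-identityʳ m)) (cong (m +_) (sym (root e²≡0)))
  where
  identity : ∀ m e → m * (m + e) + m * (m + e) + e * e ≡ m * m + (m + e) * (m + e)
  identity = solve-∀
  root : e * e ≡ 0 → e ≡ 0
  root eq with m*n≡0⇒m≡0∨n≡0 e eq
  ... | inj₁ p = p
  ... | inj₂ p = p
... | inj₂ n≤m with e , refl ← m≤n⇒∃[o]m+o≡n n≤m =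
  e * e , identity n e , λ e²≡0 → trans (cong (n +_) (root e²≡0)) (+-identityʳ n)
  where
  identity : ∀ n e → (n + e) * n + (n + e) * n + e * e ≡ (n + e) * (n + e) + n * n
  identity = solve-∀
  root : e * e ≡ 0 → e ≡ 0
  root eq with m*n≡0⇒m≡0∨n≡0 e eq
  ... | inj₁ p = p
  ... | inj₂ p = p

dot-defect : ∀ {t} (u v : Fin t → ℕ) →
  ∃[ d ] (dot u v + dot u v + d ≡ dot u u + dot v v × (d ≡ 0 → u ≗ v))
dot-defect {zero}  u v = 0 , refl , λ _ ()
dot-defect {suc t} u v
  with d₀ , eq₀ , root₀ ← square-defect (u zero) (v zero)
     | d , eq , root ← dot-defect (u ∘ suc) (v ∘ suc) =
  d₀ + d
  , trans (shuffle (u zero * v zero) (dot (u ∘ suc) (v ∘ suc)) d₀ d)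
      (trans (cong₂ _+_ eq₀ eq)
        (shuffle′ (u zero * u zero) (v zero * v zero) (dot (u ∘ suc) (u ∘ suc)) _))
  , λ { eq zero → root₀ (m+n≡0⇒m≡0 d₀ eq) ; eq (suc j) → root (m+n≡0⇒n≡0 d₀ eq) j }
  where
  shuffle : ∀ a b x y → (a + b) + (a + b) + (x + y) ≡ (a + a + x) + (b + b + y)
  shuffle = solve-∀
  shuffle′ : ∀ a b x y → (a + b) + (x + y) ≡ (a + x) + (b + y)
  shuffle′ = solve-∀

-- Cauchy-Schwarz on the sphere with its equality case: 2b = 2R - 2⟨u, v⟩ = ‖u - v‖², the sum of the
-- coordinatewise square defects.
sphere-defect : ∀ {t R} (u v : Fin t → ℕ) → dot u u ≡ R → dot v v ≡ R →
  ∃[ b ] (dot u v + b ≡ R × (b ≡ 0 → u ≗ v))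
sphere-defect {R = R} u v uu vv with d , eq , root ← dot-defect u v =
  R ∸ dot u v , m+[n∸m]≡n uv≤R , λ b≡0 → root (d≡0 (≤-antisym uv≤R (m∸n≡0⇒m≤n b≡0)))
  where
  eq′ : dot u v + dot u v + d ≡ R + R
  eq′ = trans eq (cong₂ _+_ uu vv)

  uv≤R : dot u v ≤ R
  uv≤R with ≤-<-connex (dot u v) R
  ... | inj₁ p = p
  ... | inj₂ R<uv = ⊥-elim (<-irrefl (sym eq′) (≤-trans (+-mono-< R<uv R<uv) (m≤m+n _ d)))

  d≡0 : dot u v ≡ R → d ≡ 0
  d≡0 refl = +-cancelˡ-≡ (R + R) d 0 (trans eq′ (sym (+-identityʳ _)))

-- Closed walks with directions on a sphere

cyc-inject₁ : ∀ {m} (i : Fin m) → cyc (inject₁ i) ≡ suc i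
cyc-inject₁ {m} i with toℕ (inject₁ i) <? m
... | yes p = cong suc (toℕ-injective (trans (toℕ-fromℕ< p) (toℕ-inject₁ i)))
... | no ¬p = ⊥-elim (¬p (subst (_< m) (sym (toℕ-inject₁ i)) (toℕ<n i)))

cyc-fromℕ : ∀ m → cyc (fromℕ m) ≡ zero
cyc-fromℕ m with toℕ (fromℕ m) <? m
... | yes p = ⊥-elim (<-irrefl (toℕ-fromℕ m) p)
... | no _  = refl

-- f(i) − g(i) is nondecreasing, with the subtraction moved across.
difference-chain : ∀ {m} (f g : Fin (suc m) → ℕ) →
  (∀ i → f (inject₁ i) + g (suc i) ≤ f (suc i) + g (inject₁ i)) →
  f zero + g (fromℕ m) ≤ f (fromℕ m) + g zero
difference-chain {zero}  f g step = ≤-refl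
difference-chain {suc m} f g step = +-cancelˡ-≤ (f (suc zero) + g (suc zero)) _ _ (begin
  f (suc zero) + g (suc zero) + (f zero + g (fromℕ (suc m)))
    ≡⟨ shuffle (f (suc zero)) _ (f zero) _ ⟩
  (f zero + g (suc zero)) + (f (suc zero) + g (fromℕ (suc m)))
    ≤⟨ +-mono-≤ (step zero) (difference-chain (f ∘ suc) (g ∘ suc) (step ∘ suc)) ⟩
  (f (suc zero) + g zero) + (f (fromℕ (suc m)) + g (suc zero))
    ≡⟨ shuffle′ (f (suc zero)) (g zero) (f (fromℕ (suc m))) _ ⟩
  f (suc zero) + g (suc zero) + (f (fromℕ (suc m)) + g zero) ∎)
  where
  open ≤-Reasoning
  shuffle : ∀ a b c d → a + b + (c + d) ≡ (c + b) + (a + d)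
  shuffle = solve-∀
  shuffle′ : ∀ a b c d → (a + b) + (c + d) ≡ a + d + (c + b)
  shuffle′ = solve-∀

-- Edge i is the line s ↦ xᵢ + s uᵢ. It passes through `P i` at parameter `τ i` and through the next
-- point `P (cyc i)` at that point's own parameter.
module _ {m t : ℕ} (τ : Fin (suc (suc m)) → ℕ) (u x P : Fin (suc (suc m)) → Fin t → ℕ) {R : ℕ}
  (τ-increasing : ∀ i → τ (inject₁ i) < τ (suc i))
  (norm : ∀ i → dot (u i) (u i) ≡ R)
  (leave : ∀ i j → P i j ≡ x i j + τ i * u i j)
  (arrive : ∀ i j → P (cyc i) j ≡ x i j + τ (cyc i) * u i j)
  where

  private
    last : Fin (suc (suc m))
    last = fromℕ (suc m)

    f g : Fin (suc (suc m)) → ℕ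
    f i = τ i * R
    g i = dot (P i) (u last)

    g-on : ∀ i k → (∀ j → P k j ≡ x i j + τ k * u i j) →
      g k ≡ dot (x i) (u last) + τ k * dot (u i) (u last)
    g-on i k eq = trans (sum-cong-≗ (λ j → cong (_* u last j) (eq j)))
      (dot-linear (x i) (u i) (u last) (τ k))

    arrive′ : ∀ i j → P (suc i) j ≡ x (inject₁ i) j + τ (suc i) * u (inject₁ i) j
    arrive′ i j = subst (λ k → P k j ≡ x (inject₁ i) j + τ k * u (inject₁ i) j)
      (cyc-inject₁ i) (arrive (inject₁ i) j)

    increment : ∀ i b → dot (u (inject₁ i)) (u last) + b ≡ R →
      f (inject₁ i) + g (suc i) + (τ (suc i) ∸ τ (inject₁ i)) * b ≡ f (suc i) + g (inject₁ i)
    increment i b eq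
      rewrite g-on (inject₁ i) (inject₁ i) (leave (inject₁ i)) | g-on (inject₁ i) (suc i) (arrive′ i) | sym eq
      -- Writing `τ (suc i)` as `τ₀ + δ` removes the truncated subtraction and leaves a polynomial
      -- identity.
      = subst
          (λ T → τ₀ * (s + b) + (X + T * s) + (τ (suc i) ∸ τ₀) * b ≡ T * (s + b) + (X + τ₀ * s))
          (m+[n∸m]≡n (<⇒≤ (τ-increasing i)))
          (identity τ₀ s b X (τ (suc i) ∸ τ₀))
      where
      τ₀ = τ (inject₁ i)
      s = dot (u (inject₁ i)) (u last)
      X = dot (x (inject₁ i)) (u last)
      identity : ∀ τ₀ s b X δ →
        τ₀ * (s + b) + (X + (τ₀ + δ) * s) + δ * b ≡ (τ₀ + δ) * (s + b) + (X + τ₀ * s)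
      identity = solve-∀

    -- The last line has direction `u last` itself, of squared norm `R`, so the potential is
    -- -⟨x_last, u_last⟩ at both of its points.
    closing : f zero + g last ≡ f last + g zero
    closing rewrite g-on last last (leave last)
        | g-on last zero (subst (λ k → ∀ j → P k j ≡ x last j + τ k * u last j) (cyc-fromℕ (suc m)) (arrive last))
        | norm last = shuffle (τ zero * R) (dot (x last) (u last)) (τ last * R)
      where
      shuffle : ∀ a b c → a + (b + c) ≡ c + (b + a)
      shuffle = solve-∀

  -- The potential f(i) − g(i) = τᵢ R − ⟨Pᵢ, u_last⟩ increases by
  -- (τᵢ₊₁ − τᵢ)(R − ⟨uᵢ, u_last⟩) ≥ 0 at each step, and returns to its initial value.
  closed-walk-on-sphere : u zero ≗ u last
  closed-walk-on-sphere with b , eq , root ← sphere-defect (u zero) (u last) (norm zero) (norm last)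
    = root b≡0
    where
    step : ∀ i → f (inject₁ i) + g (suc i) ≤ f (suc i) + g (inject₁ i)
    step i with b′ , eq′ , _ ← sphere-defect (u (inject₁ i)) (u last) (norm _) (norm last)
      = ≤-trans (m≤m+n _ _) (≤-reflexive (increment i b′ eq′))

    rest : f (suc zero) + g last ≤ f last + g (suc zero)
    rest = difference-chain (f ∘ suc) (g ∘ suc) (step ∘ suc)

    δ = τ (suc zero) ∸ τ zero

    -- The first increment is kept exactly and the later ones are bounded below by 0; returning to
    -- the initial value leaves no room for `δ * b`.
    δb≤0 : δ * b ≤ 0
    δb≤0 = +-cancelˡ-≤ (f zero + g (suc zero) + (f (suc zero) + g last)) _ _ (begin
      f zero + g (suc zero) + (f (suc zero) + g last) + δ * b
        ≡⟨ shuffle (f zero + g (suc zero)) _ _ ⟩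
      (f zero + g (suc zero) + δ * b) + (f (suc zero) + g last)
        ≤⟨ +-mono-≤ (≤-reflexive (increment zero b eq)) rest ⟩
      (f (suc zero) + g zero) + (f last + g (suc zero))
        ≡⟨ shuffle′ (f (suc zero)) (g zero) (f last) _ ⟩
      (f last + g zero) + (f (suc zero) + g (suc zero))
        ≡⟨ cong (_+ (f (suc zero) + g (suc zero))) closing ⟨
      (f zero + g last) + (f (suc zero) + g (suc zero))
        ≡⟨ shuffle″ (f zero) (g last) (f (suc zero)) _ ⟩
      f zero + g (suc zero) + (f (suc zero) + g last) + 0 ∎)
      where
      open ≤-Reasoning
      shuffle : ∀ a b c → a + b + c ≡ a + c + b
      shuffle = solve-∀
      shuffle′ : ∀ a b c d → a + b + (c + d) ≡ c + b + (a + d)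
      shuffle′ = solve-∀
      shuffle″ : ∀ a b c d → a + b + (c + d) ≡ a + d + (c + b) + 0
      shuffle″ = solve-∀

    b≡0 : b ≡ 0
    b≡0 with m*n≡0⇒m≡0∨n≡0 δ (n≤0⇒n≡0 δb≤0)
    ... | inj₁ δ≡0 = ⊥-elim (<⇒≱ (τ-increasing zero) (m∸n≡0⇒m≤n δ≡0))
    ... | inj₂ p   = p

-- Pigeonhole principle

lookup-injective : ∀ {A : Set} {xs : List A} → Unique xs → Injective _≡_ _≡_ (List.lookup xs)
lookup-injective (x∉xs ∷ uniq) {zero}  {zero}  eq = refl
lookup-injective (x∉xs ∷ uniq) {zero}  {suc j} eq = ⊥-elim (All.lookup x∉xs (∈-lookup j) eq)
lookup-injective (x∉xs ∷ uniq) {suc i} {zero}  eq = ⊥-elim (All.lookup x∉xs (∈-lookup i) (sym eq))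
lookup-injective (x∉xs ∷ uniq) {suc i} {suc j} eq = cong suc (lookup-injective uniq eq)

length-filter-split : ∀ {A : Set} {P : A → Set} (P? : ∀ x → Dec (P x)) xs →
  length xs ≡ length (filter P? xs) + length (filter (¬? ∘ P?) xs)
length-filter-split P? []       = refl
length-filter-split P? (x ∷ xs) with P? x
... | yes _ = cong suc (length-filter-split P? xs)
... | no  _ = trans (cong suc (length-filter-split P? xs)) (sym (+-suc _ _))

-- Induction on the number of colours: either the class of the top colour is large enough, or it is
-- discarded and the remaining colours supply the class.
large-colour-class : ∀ {A : Set} (χ : A → ℕ) C xs → Unique xs → All (λ x → χ x < C) xs →
  ∃[ ys ] (Unique ys × (∃[ c ] All (λ y → χ y ≡ c) ys) × length xs ≤ C * length ys)
large-colour-class χ zero    []       _    []       = [] , [] , (0 , []) , z≤n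
large-colour-class χ (suc C) xs uniq χ<
  with ≤-<-connex (length xs) (suc C * length (filter (λ x → χ x ℕ.≟ C) xs))
... | inj₁ enough =
  filter (λ x → χ x ℕ.≟ C) xs , Unique.filter⁺ (λ x → χ x ℕ.≟ C) uniq
  , (C , All.all-filter (λ x → χ x ℕ.≟ C) xs) , enough
... | inj₂ few
  with ys , uniq′ , mono , rest≤ ← large-colour-class χ C (filter (λ x → ¬? (χ x ℕ.≟ C)) xs)
    (Unique.filter⁺ (λ x → ¬? (χ x ℕ.≟ C)) uniq)
    (All.zipWith (λ { (s≤s p , q) → ≤∧≢⇒< p q })
      (All.filter⁺ (λ x → ¬? (χ x ℕ.≟ C)) χ< , All.all-filter (λ x → ¬? (χ x ℕ.≟ C)) xs))
  = ys , uniq′ , mono , (begin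
      length xs                       ≡⟨ split ⟩
      length zs + length rest         ≤⟨ +-mono-≤ zs≤ys rest≤ ⟩
      length ys + C * length ys       ∎)
  where
  open ≤-Reasoning
  zs = filter (λ x → χ x ℕ.≟ C) xs
  rest = filter (λ x → ¬? (χ x ℕ.≟ C)) xs
  split = length-filter-split (λ x → χ x ℕ.≟ C) xs

  zs≤ys : length zs ≤ length ys
  -- From (C + 1)|zs| < |zs| + |rest| follows C|zs| < |rest| ≤ C|ys|.
  zs≤ys = <⇒≤ (*-cancelˡ-< C _ _
    (<-≤-trans (+-cancelˡ-< (length zs) _ _ (subst (suc C * length zs <_) split few)) rest≤))

pigeonhole-class : ∀ {a C} (χ : Fin a → Fin C) →
  ∃[ s ] Σ (Fin s → Fin a) λ ι → Injective _≡_ _≡_ ι × (∀ i j → χ (ι i) ≡ χ (ι j)) × a ≤ C * s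
pigeonhole-class {a} {C} χ
  with ys , uniq , (c , mono) , a≤ ← large-colour-class (toℕ ∘ χ) C (List.allFin a)
    (Unique.allFin⁺ a) (All.tabulate⁺ (λ i → toℕ<n (χ i)))
  = length ys , List.lookup ys , lookup-injective uniq
  , (λ i j → toℕ-injective (trans (All.lookup mono (∈-lookup i)) (sym (All.lookup mono (∈-lookup j)))))
  , subst (_≤ C * length ys) (length-tabulate id) a≤

-- Hypergraphs whose parts are numbered by residues mod r

-- `F a p` is the label of the vertex of edge `a` in part `p`. Label `c` in part `p` becomes the
-- vertex `r * c + p`, so reduction mod `r` gives a part to every element of `Fin n`, including the
-- isolated vertices from `M * r` on.
module _ {r M E n : ℕ} .{{_ : NonZero r}} (F : Fin E → Fin r → Fin M) (Mr≤n : M * r ≤ n)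
  {p₀ p₁ : Fin r} (p₀≢p₁ : p₀ ≢ p₁)
  (separated : ∀ a b p q → p ≢ q → F a p ≡ F b p → F a q ≡ F b q → a ≡ b)
  where

  private
    vertex : Fin r → Fin M → Fin n
    vertex p c = inject≤ (combine c p) Mr≤n

    vertex-injective : ∀ p {c d} → vertex p c ≡ vertex p d → c ≡ d
    vertex-injective p eq = combine-injectiveˡ _ p _ p (inject≤-injective _ _ _ _ eq)

    residue : Fin n → Fin r
    residue v = toℕ v mod r

    residue-vertex : ∀ p c → residue (vertex p c) ≡ p
    residue-vertex p c = toℕ-injective (begin
      toℕ (residue (vertex p c))      ≡⟨ toℕ-fromℕ< _ ⟩
      toℕ (vertex p c) % r            ≡⟨ cong (_% r) (trans (toℕ-inject≤ _ Mr≤n) (toℕ-combine c p)) ⟩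
      (r * toℕ c + toℕ p) % r         ≡⟨ cong (_% r) (trans (+-comm _ (toℕ p)) (cong (toℕ p +_) (*-comm r _))) ⟩
      (toℕ p + toℕ c * r) % r         ≡⟨ [m+kn]%n≡m%n (toℕ p) (toℕ c) r ⟩
      toℕ p % r                       ≡⟨ m<n⇒m%n≡m (toℕ<n p) ⟩
      toℕ p                           ∎)
      where open ≡-Reasoning

    edgeVec : Fin E → Vec (Fin n) r
    edgeVec a = Vec.tabulate (λ p → vertex p (F a p))

    lookup-edgeVec : ∀ a p → lookup (edgeVec a) p ≡ vertex p (F a p)
    lookup-edgeVec a p = lookup∘tabulate _ p

    edgeVec-injective : ∀ {a b} → edgeVec a ≡ edgeVec b → a ≡ b
    edgeVec-injective {a} {b} eq = separated a b p₀ p₁ p₀≢p₁ (agree p₀) (agree p₁)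
      where
      agree : ∀ p → F a p ≡ F b p
      agree p = vertex-injective p
        (trans (sym (lookup-edgeVec a p)) (trans (cong (λ e → lookup e p) eq) (lookup-edgeVec b p)))

  hypergraph : Hypergraph r n
  hypergraph = record
    { part     = residue
    ; edges    = List.tabulate edgeVec
    ; partite  = All.tabulate⁺ (λ a p → trans (cong residue (lookup-edgeVec a p)) (residue-vertex p _))
    ; distinct = Unique.tabulate⁺ edgeVec-injective
    }

  numEdges-hypergraph : numEdges hypergraph ≡ E
  numEdges-hypergraph = length-tabulate edgeVec

  private
    index : Edge hypergraph → Fin E
    index = cast numEdges-hypergraph

    index-injective : ∀ {a b} → index a ≡ index b → a ≡ b
    index-injective {a} {b} eq = toℕ-injective
      (trans (sym (toℕ-cast _ a)) (trans (cong toℕ eq) (toℕ-cast _ b)))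

    edge-index : ∀ a → edge hypergraph a ≡ edgeVec (index a)
    edge-index a = trans
      (cong (List.lookup (List.tabulate edgeVec)) (sym (cast-involutive _ numEdges-hypergraph a)))
      (lookup-tabulate edgeVec (index a))

    member : ∀ {v} a → _∈E_ hypergraph v a → v ≡ vertex (residue v) (F (index a) (residue v))
    member a (p , refl) rewrite edge-index a
      | lookup-edgeVec (index a) p | residue-vertex p (F (index a) p) = refl

    agreement : ∀ {v} a b → _∈E_ hypergraph v a → _∈E_ hypergraph v b →
      F (index a) (residue v) ≡ F (index b) (residue v)
    agreement a b v∈a v∈b = vertex-injective _ (trans (sym (member a v∈a)) (member b v∈b))

  -- Common vertices in one part coincide because an edge has a single vertex there; common vertices
  -- in two parts would make the edges equal by `separated`.
  hypergraph-linear : Linear hypergraph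
  hypergraph-linear a b a≢b u w u∈a u∈b w∈a w∈b with residue u ≟ residue w
  ... | yes same = trans (member a u∈a)
    (trans (cong (λ p → vertex p (F (index a) p)) same) (sym (member a w∈a)))
  ... | no  distinct-parts = ⊥-elim (a≢b (index-injective
    (separated _ _ _ _ distinct-parts (agreement a b u∈a u∈b) (agreement a b w∈a w∈b))))

  -- The vertex v_{i+1} lies in both A_i and A_{i+1}, so these edges have the same label in its
  -- part.
  rainbow-cycle-codes : ∀ {m} → RainbowCycle hypergraph m →
    Σ (Fin (suc m) → Fin r) λ ρ → Σ (Fin (suc m) → Fin E) λ A →
      Injective _≡_ _≡_ ρ × Injective _≡_ _≡_ A ×
      (∀ i → F (A i) (ρ (cyc i)) ≡ F (A (cyc i)) (ρ (cyc i)))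
  rainbow-cycle-codes (v , A , _ , A-inj , inc , rainbow) =
    residue ∘ v , index ∘ A , rainbow , A-inj ∘ index-injective ,
    λ i → agreement (A i) (A (cyc i)) (proj₂ (inc i)) (proj₁ (inc (cyc i)))

-- Finite sums and codes of finite functions

sum-bound : ∀ {m} (f : Fin m → ℕ) {c} → (∀ i → f i ≤ c) → sum f ≤ m * c
sum-bound {zero}  f f≤c = z≤n
sum-bound {suc m} f f≤c = +-mono-≤ (f≤c zero) (sum-bound (f ∘ suc) (f≤c ∘ suc))

indicator : ∀ {m} → Fin m → Fin m → ℕ
indicator i k = if does (i ≟ k) then 1 else 0

indicator≤1 : ∀ {m} (i k : Fin m) → indicator i k ≤ 1
indicator≤1 i k with does (i ≟ k)
... | true  = ≤-refl
... | false = z≤n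

indicator-suc : ∀ {m} (i k : Fin m) → indicator (suc i) (suc k) ≡ indicator i k
indicator-suc i k with i ≟ k
... | yes _ = refl
... | no  _ = refl

indicator-sym : ∀ {m} (i k : Fin m) → indicator i k ≡ indicator k i
indicator-sym i k with i ≟ k | k ≟ i
... | yes _    | yes _  = refl
... | no  _    | no  _  = refl
... | yes refl | no k≢k = ⊥-elim (k≢k refl)
... | no  i≢i  | yes refl = ⊥-elim (i≢i refl)

sum-indicator : ∀ {m} (i : Fin m) (w : Fin m → ℕ) → sum (λ k → indicator i k * w k) ≡ w i
sum-indicator {suc m} zero    w = begin
  w zero + 0 + sum (λ k → indicator zero (suc k) * w (suc k))
    ≡⟨ cong (w zero + 0 +_) (sum-replicate-zero m) ⟩
  w zero + 0 + 0
    ≡⟨ trans (+-identityʳ _) (+-identityʳ _) ⟩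
  w zero ∎
  where open ≡-Reasoning
sum-indicator {suc m} (suc i) w =
  trans (sum-cong-≗ (λ k → cong (_* w (suc k)) (indicator-suc i k))) (sum-indicator i (w ∘ suc))

funToFin-injective : ∀ {m n} {f g : Fin m → Fin n} → funToFin f ≡ funToFin g → f ≗ g
funToFin-injective {f = f} {g} eq i =
  trans (sym (finToFun-funToFin f i)) (trans (cong (λ c → finToFun c i) eq) (finToFun-funToFin g i))

funToFin-cong : ∀ {m n} {f g : Fin m → Fin n} → f ≗ g → funToFin f ≡ funToFin g
funToFin-cong {zero}  f≗g = refl
funToFin-cong {suc m} f≗g = cong₂ combine (f≗g zero) (funToFin-cong (f≗g ∘ suc))

finToFun-injective : ∀ {m n} {c d : Fin (n ^ m)} → finToFun {n} {m} c ≗ finToFun d → c ≡ d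
finToFun-injective {m} {n} {c} {d} eq =
  trans (sym (funToFin-finToFin {m} {n} c)) (trans (funToFin-cong eq) (funToFin-finToFin {m} {n} d))

remQuot-injective : ∀ {m} k {i j : Fin (m * k)} → remQuot {m} k i ≡ remQuot k j → i ≡ j
remQuot-injective {m} k {i} {j} eq =
  trans (sym (combine-remQuot {m} k i)) (trans (cong (uncurry combine) eq) (combine-remQuot {m} k j))

-- A `t`-tuple of polynomials with `J` coefficients in [0, K), stored as a number so that vertices
-- and edges are counted by the type itself.
Array : (K J t : ℕ) → Set
Array K J t = Fin ((K ^ J) ^ t)

entry : ∀ {K J t} → Array K J t → Fin t → Fin J → ℕ
entry {K} {J} {t} c j α = toℕ (finToFun {K} {J} (finToFun {K ^ J} {t} c j) α)

entry-injective : ∀ {K J t} {c d : Array K J t} → (∀ j → entry {K} {J} c j ≗ entry {K} {J} d j) → c ≡ d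
entry-injective {K} {J} {t} eq =
  finToFun-injective {t} {K ^ J} (λ j → finToFun-injective {J} {K} (λ α → toℕ-injective (eq j α)))

entry< : ∀ {K J t} (c : Array K J t) j α → entry {K} {J} c j α < K
entry< {K} {J} {t} c j α = toℕ<n (finToFun {K} {J} (finToFun {K ^ J} {t} c j) α)

-- Subtracting the two equations leaves (q - p)u = (q - p)v.
two-points-determine-line : ∀ {a b u v p q} → p < q →
  a + p * u ≡ b + p * v → a + q * u ≡ b + q * v → u ≡ v
two-points-determine-line {a} {b} {u} {v} {p} p<q at-p at-q
  with e , refl ← m≤n⇒∃[o]m+o≡n p<q =
  *-cancelˡ-≡ u v (suc e) (+-cancelˡ-≡ (a + p * u) _ _ (begin
    a + p * u + suc e * u      ≡⟨ split a p e u ⟨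
    a + (suc p + e) * u        ≡⟨ at-q ⟩
    b + (suc p + e) * v        ≡⟨ split b p e v ⟩
    b + p * v + suc e * v      ≡⟨ cong (_+ suc e * v) at-p ⟨
    a + p * u + suc e * v      ∎))
  where
  open ≡-Reasoning
  split : ∀ a p e u → a + (suc p + e) * u ≡ a + p * u + suc e * u
  split = solve-∀

-- The polynomial construction

module Construction (r T t K l : ℕ) (1≤T : 1 ≤ T) (2≤K : 2 ≤ K) where

  -- `J` and `J′` count the monomials of positions and directions. `V` bounds the coefficients of
  -- vertices, `E` the degrees of direction monomials, `U` the values of direction polynomials and
  -- `Q` the norms.
  B J J′ V E U Q : ℕ
  B  = suc T
  J  = B ^ r
  J′ = T ^ r
  V  = suc J′ * K
  E  = r * (T * B ^ (suc l * r))
  U  = J′ * (K * K ^ E)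
  Q  = suc (t * (U * U))

  private
    instance
      K≢0 : NonZero K
      K≢0 = >-nonZero (≤-trans (s≤s z≤n) 2≤K)

  -- A ranking h of the parts orders the variables z₀, …, z_{r-1}: the variable
  -- z_i is evaluated at K ^ (B ^ rank h i), so that z_i ≪ z_k when h i < h k, and the
  -- monomial with exponents a takes the value K ^ degree h a.
  Ranking : Set
  Ranking = Fin r → Fin (suc l)

  -- Pairing with `i` breaks ties, so different parts have different ranks even where `h` repeats a
  -- value.
  rank : Ranking → Fin r → ℕ
  rank h i = toℕ (combine (h i) i)

  rank-injective : ∀ h → Injective _≡_ _≡_ (rank h)
  rank-injective h eq = combine-injectiveʳ (h _) _ (h _) _ (toℕ-injective eq)

  degree : Ranking → (Fin r → ℕ) → ℕ
  degree h a = sum (λ i → a i * B ^ rank h i)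

  -- Kronecker substitution: the exponents are the base-`B` digits of the degree, so distinct
  -- monomials become distinct powers of `K`.
  degree-injective : ∀ h {a b} → (∀ i → a i < B) → (∀ i → b i < B) → degree h a ≡ degree h b → a ≗ b
  degree-injective h {a} {b} a<B b<B = digits-unique B (rank h) (rank-injective h) a b a<B b<B

  exponent : Fin J → Fin r → ℕ
  exponent α i = toℕ (finToFun {B} {r} α i)

  exponent′ : Fin J′ → Fin r → ℕ
  exponent′ β i = toℕ (finToFun {T} {r} β i)

  exponent′<T : ∀ β i → exponent′ β i < T
  exponent′<T β i = toℕ<n (finToFun {T} {r} β i)

  monomial : Ranking → Fin J → ℕ
  monomial h α = K ^ degree h (exponent α)

  monomial′ : Ranking → Fin J′ → ℕ
  monomial′ h β = K ^ degree h (exponent′ β)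

  variable-value : Ranking → Fin r → ℕ
  variable-value h p = K ^ (B ^ rank h p)

  eval : Ranking → (Fin J → ℕ) → ℕ
  eval h y = sum (λ α → y α * monomial h α)

  eval′ : Ranking → (Fin J′ → ℕ) → ℕ
  eval′ h y = sum (λ β → y β * monomial′ h β)

  variable-value-mono : ∀ h {p q} → rank h p < rank h q → variable-value h p < variable-value h q
  variable-value-mono h p<q = ^-monoʳ-< K 2≤K (^-monoʳ-< B (s≤s 1≤T) p<q)

  bump : Fin r → (Fin r → Fin T) → Fin r → Fin B
  bump p a i = if does (i ≟ p) then suc (a i) else inject₁ (a i)

  toℕ-bump : ∀ p a i → toℕ (bump p a i) ≡ toℕ (a i) + indicator i p
  toℕ-bump p a i with does (i ≟ p)
  ... | true  = sym (+-comm (toℕ (a i)) 1)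
  ... | false = trans (toℕ-inject₁ (a i)) (sym (+-identityʳ _))

  -- Multiplication of a monomial by z_p. Exponents below `T` leave room for the increase inside
  -- [0, T].
  shift : Fin r → Fin J′ → Fin J
  shift p β = funToFin (bump p (finToFun {T} {r} β))

  degree-shift : ∀ h p β → degree h (exponent (shift p β)) ≡ B ^ rank h p + degree h (exponent′ β)
  degree-shift h p β = begin
    sum (λ i → exponent (shift p β) i * B ^ rank h i)
      ≡⟨ sum-cong-≗ (λ i → trans
           (cong (λ e → e * B ^ rank h i)
             (trans (cong toℕ (finToFun-funToFin (bump p (finToFun {T} {r} β)) i))
               (toℕ-bump p (finToFun {T} {r} β) i)))
           (trans (cong (λ e → (exponent′ β i + e) * B ^ rank h i) (indicator-sym i p))
             (*-distribʳ-+ (B ^ rank h i) (exponent′ β i) (indicator p i)))) ⟩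
    sum (λ i → exponent′ β i * B ^ rank h i + indicator p i * B ^ rank h i)
      ≡⟨ ∑-distrib-+ (λ i → exponent′ β i * B ^ rank h i) (λ i → indicator p i * B ^ rank h i) ⟩
    degree h (exponent′ β) + sum (λ i → indicator p i * B ^ rank h i)
      ≡⟨ cong (degree h (exponent′ β) +_) (sum-indicator p (λ i → B ^ rank h i)) ⟩
    degree h (exponent′ β) + B ^ rank h p
      ≡⟨ +-comm (degree h (exponent′ β)) _ ⟩
    B ^ rank h p + degree h (exponent′ β) ∎
    where open ≡-Reasoning

  monomial-shift : ∀ h p β → monomial h (shift p β) ≡ variable-value h p * monomial′ h β
  monomial-shift h p β =
    trans (cong (K ^_) (degree-shift h p β)) (^-distribˡ-+-* K (B ^ rank h p) _)

  -- The coefficients of z_p y. The indicator form lets `eval-shifted` exchange the two sums and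
  -- collapse the inner one.
  shifted : Fin r → (Fin J′ → ℕ) → Fin J → ℕ
  shifted p y α = sum (λ β → indicator (shift p β) α * y β)

  shifted≤ : ∀ p y α → (∀ β → y β ≤ K) → shifted p y α ≤ J′ * K
  shifted≤ p y α y≤K = sum-bound _ (λ β →
    ≤-trans (*-mono-≤ (indicator≤1 (shift p β) α) (y≤K β)) (≤-reflexive (+-identityʳ K)))

  eval-shifted : ∀ h p y → eval h (shifted p y) ≡ variable-value h p * eval′ h y
  eval-shifted h p y = begin
    sum (λ α → sum (λ β → indicator (shift p β) α * y β) * monomial h α)
      ≡⟨ sum-cong-≗ (λ α → *-distribʳ-sum (monomial h α) (λ β → indicator (shift p β) α * y β)) ⟩
    sum (λ α → sum (λ β → indicator (shift p β) α * y β * monomial h α))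
      ≡⟨ ∑-comm (λ α β → indicator (shift p β) α * y β * monomial h α) ⟩
    sum (λ β → sum (λ α → indicator (shift p β) α * y β * monomial h α))
      ≡⟨ sum-cong-≗ (λ β → sum-cong-≗ (λ α → *-assoc (indicator (shift p β) α) (y β) (monomial h α))) ⟩
    sum (λ β → sum (λ α → indicator (shift p β) α * (y β * monomial h α)))
      ≡⟨ sum-cong-≗ (λ β → sum-indicator (shift p β) (λ α → y β * monomial h α)) ⟩
    sum (λ β → y β * monomial h (shift p β))
      ≡⟨ sum-cong-≗ (λ β → trans (cong (y β *_) (monomial-shift h p β))
           (swap (y β) (variable-value h p) (monomial′ h β))) ⟩
    sum (λ β → variable-value h p * (y β * monomial′ h β))
      ≡⟨ *-distribˡ-sum (variable-value h p) (λ β → y β * monomial′ h β) ⟨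
    variable-value h p * eval′ h y ∎
    where
    open ≡-Reasoning
    swap : ∀ a b c → a * (b * c) ≡ b * (a * c)
    swap = solve-∀

  -- The coefficients are base-`K` digits at distinct powers of `K`, so one evaluation determines
  -- the polynomial.
  eval′-injective : ∀ h {y y′} → (∀ β → y β < K) → (∀ β → y′ β < K) → eval′ h y ≡ eval′ h y′ → y ≗ y′
  eval′-injective h {y} {y′} = digits-unique K (λ β → degree h (exponent′ β))
    (λ {β} {β′} eq → finToFun-injective {r} {T} (λ i → toℕ-injective
      (degree-injective h (λ k → m≤n⇒m≤1+n (exponent′<T β k)) (λ k → m≤n⇒m≤1+n (exponent′<T β′ k)) eq i)))
    y y′

  Position Direction : Set
  Position  = Array K J t
  Direction = Array K J′ t

  at : Position → Fin t → Fin J → ℕ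
  at = entry {K} {J} {t}

  at′ : Direction → Fin t → Fin J′ → ℕ
  at′ = entry {K} {J′} {t}

  evals : Ranking → Position → Fin t → ℕ
  evals h x j = eval h (at x j)

  evals′ : Ranking → Direction → Fin t → ℕ
  evals′ h d j = eval′ h (at′ d j)

  evals′-injective : ∀ h {d d′} → evals′ h d ≗ evals′ h d′ → d ≡ d′
  evals′-injective h {d} {d′} eq = entry-injective {K} {J′} {t}
    (λ j → eval′-injective h (entry< {K} {J′} d j) (entry< {K} {J′} d′ j) (eq j))

  value : Position → Direction → Fin r → Fin t → Fin J → ℕ
  value x d p j α = at x j α + shifted p (at′ d j) α

  value<V : ∀ x d p j α → value x d p j α < V
  value<V x d p j α = +-mono-<-≤ (entry< {K} {J} x j α)
    (shifted≤ p (at′ d j) α (λ β → <⇒≤ (entry< {K} {J′} d j β)))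

  code : Position → Direction → Fin r → Array V J t
  code x d p = funToFin (λ j → funToFin (λ α → fromℕ< (value<V x d p j α)))

  code-injective : ∀ {x d x′ d′ p} → code x d p ≡ code x′ d′ p → ∀ j → value x d p j ≗ value x′ d′ p j
  code-injective eq j α = trans (sym (toℕ-fromℕ< _))
    (trans (cong toℕ (funToFin-injective (funToFin-injective eq j) α)) (toℕ-fromℕ< _))

  eval-value : ∀ h x d p j → eval h (value x d p j) ≡ evals h x j + variable-value h p * evals′ h d j
  eval-value h x d p j = begin
    sum (λ α → (at x j α + shifted p (at′ d j) α) * monomial h α)
      ≡⟨ sum-cong-≗ (λ α → *-distribʳ-+ (monomial h α) (at x j α) _) ⟩
    sum (λ α → at x j α * monomial h α + shifted p (at′ d j) α * monomial h α)
      ≡⟨ ∑-distrib-+ (λ α → at x j α * monomial h α) (λ α → shifted p (at′ d j) α * monomial h α) ⟩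
    evals h x j + eval h (shifted p (at′ d j))
      ≡⟨ cong (evals h x j +_) (eval-shifted h p (at′ d j)) ⟩
    evals h x j + variable-value h p * evals′ h d j ∎
    where open ≡-Reasoning

  code-agree : ∀ h {x d x′ d′ p} → code x d p ≡ code x′ d′ p → ∀ j →
    evals h x j + variable-value h p * evals′ h d j ≡ evals h x′ j + variable-value h p * evals′ h d′ j
  code-agree h {x} {d} {x′} {d′} {p} eq j =
    trans (sym (eval-value h x d p j))
      (trans (sum-cong-≗ (λ α → cong (_* monomial h α) (code-injective {x} {d} {x′} {d′} {p} eq j α)))
        (eval-value h x′ d′ p j))

  code-same-direction : ∀ {x x′ d d′ p} → d ≡ d′ → code x d p ≡ code x′ d′ p → x ≡ x′
  code-same-direction {x} {x′} {d} {.d} {p} refl eq = entry-injective {K} {J} {t}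
    (λ j α → +-cancelʳ-≡ (shifted p (at′ d j) α) _ _ (code-injective {x} {d} {x′} {d} {p} eq j α))

  code-separated : ∀ x d x′ d′ p q → p ≢ q →
    code x d p ≡ code x′ d′ p → code x d q ≡ code x′ d′ q → x ≡ x′ × d ≡ d′
  code-separated x d x′ d′ p q p≢q at-p at-q = code-same-direction {p = p} same at-p , same
    where
    h : Ranking
    -- Any ranking serves here, since the values of z_p and z_q differ as soon as the ranks do.
    h _ = zero

    same-eval : evals′ h d ≗ evals′ h d′
    same-eval j with <-cmp (rank h p) (rank h q)
    ... | tri< p<q _ _ = two-points-determine-line {a = evals h x j} {b = evals h x′ j}
      (variable-value-mono h p<q)
      (code-agree h {x} {d} {x′} {d′} {p} at-p j) (code-agree h {x} {d} {x′} {d′} {q} at-q j)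
    ... | tri≈ _ p≡q _ = ⊥-elim (p≢q (rank-injective h p≡q))
    ... | tri> _ _ q<p = two-points-determine-line {a = evals h x j} {b = evals h x′ j}
      (variable-value-mono h q<p)
      (code-agree h {x} {d} {x′} {d′} {q} at-q j) (code-agree h {x} {d} {x′} {d′} {p} at-p j)

    same : d ≡ d′
    same = evals′-injective h same-eval

  rank≤ : ∀ h i → rank h i ≤ suc l * r
  rank≤ h i = <⇒≤ (toℕ<n (combine (h i) i))

  degree≤E : ∀ h β → degree h (exponent′ β) ≤ E
  degree≤E h β = sum-bound _ (λ i →
    *-mono-≤ (<⇒≤ (exponent′<T β i)) (^-monoʳ-≤ B (rank≤ h i)))

  evals′≤U : ∀ h d j → evals′ h d j ≤ U
  evals′≤U h d j = sum-bound _ (λ β →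
    *-mono-≤ (<⇒≤ (entry< {K} {J′} d j β)) (^-monoʳ-≤ K (degree≤E h β)))

  norm : Ranking → Direction → ℕ
  norm h d = dot (evals′ h d) (evals′ h d)

  norm<Q : ∀ h d → norm h d < Q
  norm<Q h d = s≤s (sum-bound _ (λ j → *-mono-≤ (evals′≤U h d j) (evals′≤U h d j)))

  -- The norms at all rankings are recorded together: directions are selected before any cycle is
  -- given, and the ranking to be used depends on the cycle.
  norms : Direction → Fin (Q ^ (suc l ^ r))
  norms d = funToFin (λ c → fromℕ< (norm<Q (finToFun {suc l} {r} c) d))

  norms-agree : ∀ {d d′} → norms d ≡ norms d′ →
    ∀ c → norm (finToFun {suc l} {r} c) d ≡ norm (finToFun {suc l} {r} c) d′
  norms-agree eq c = trans (sym (toℕ-fromℕ< _)) (trans (cong toℕ (funToFin-injective eq c)) (toℕ-fromℕ< _))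

  -- Edges with directions from one norm class

  module Edges {s : ℕ} (ι : Fin s → Direction) (ι-injective : Injective _≡_ _≡_ ι)
    (equal-norms : ∀ i j → norms (ι i) ≡ norms (ι j)) where

    #edges : ℕ
    #edges = (K ^ J) ^ t * s

    position : Fin #edges → Position
    position a = proj₁ (remQuot {(K ^ J) ^ t} s a)

    direction : Fin #edges → Direction
    direction a = ι (proj₂ (remQuot {(K ^ J) ^ t} s a))

    edge-injective : ∀ {a b} → position a ≡ position b → direction a ≡ direction b → a ≡ b
    edge-injective x≡ d≡ = remQuot-injective {(K ^ J) ^ t} s (cong₂ _,_ x≡ (ι-injective d≡))

    F : Fin #edges → Fin r → Array V J t
    F a = code (position a) (direction a)

    F-separated : ∀ a b p q → p ≢ q → F a p ≡ F b p → F a q ≡ F b q → a ≡ b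
    F-separated a b p q p≢q at-p at-q = uncurry edge-injective
      (code-separated (position a) (direction a) (position b) (direction b) p q p≢q at-p at-q)

    -- Ranking the parts in the order in which the cycle visits them makes
    -- every step but the last one increasing.
    no-rainbow-cycle : ∀ {m} → suc m ≤ l →
      (ρ : Fin (suc (suc m)) → Fin r) (A : Fin (suc (suc m)) → Fin #edges) →
      Injective _≡_ _≡_ ρ → Injective _≡_ _≡_ A →
      ¬ (∀ i → F (A i) (ρ (cyc i)) ≡ F (A (cyc i)) (ρ (cyc i)))
    no-rainbow-cycle {m} m<l ρ A ρ-inj A-inj arrival = 0≢last (A-inj (edge-injective same-position same-direction))
      where
      last : Fin (suc (suc m))
      last = fromℕ (suc m)

      0≢last : zero ≢ last
      0≢last ()

      visit-time : Ranking
      visit-time p with any? (λ i → ρ i ≟ p)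
      ... | yes (i , _) = inject≤ i (s≤s m<l)
      -- Parts off the cycle get an arbitrary time; only ranks of visited parts are compared.
      ... | no  _       = zero

      visit-time-ρ : ∀ i → toℕ (visit-time (ρ i)) ≡ toℕ i
      visit-time-ρ i with any? (λ k → ρ k ≟ ρ i)
      ... | yes (k , ρk≡ρi) = trans (toℕ-inject≤ k (s≤s m<l)) (cong toℕ (ρ-inj ρk≡ρi))
      ... | no  ∄           = ⊥-elim (∄ (i , refl))

      -- Passing through its code makes `h` literally one of the rankings recorded in `norms`.
      h : Ranking
      h = finToFun (funToFin visit-time)

      h-ρ : ∀ i → toℕ (h (ρ i)) ≡ toℕ i
      h-ρ i = trans (cong toℕ (finToFun-funToFin visit-time (ρ i))) (visit-time-ρ i)

      h-increasing : ∀ i → toℕ (h (ρ (inject₁ i))) < toℕ (h (ρ (suc i)))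
      h-increasing i rewrite h-ρ (inject₁ i) | h-ρ (suc i) | toℕ-inject₁ i = ≤-refl

      same-direction : direction (A zero) ≡ direction (A last)
      same-direction = evals′-injective h (closed-walk-on-sphere
        (λ i → variable-value h (ρ i))
        (λ i → evals′ h (direction (A i)))
        (λ i → evals h (position (A i)))
        -- The point of the walk is the evaluated vertex of `A i` in part `ρ i`; `arrival` puts the
        -- next one on the line of `A i` too.
        (λ i j → eval h (value (position (A i)) (direction (A i)) (ρ i) j))
        (λ i → variable-value-mono h (combine-monoˡ-< _ _ (h-increasing i)))
        (λ i → norms-agree (equal-norms _ (proj₂ (remQuot {(K ^ J) ^ t} s (A zero)))) (funToFin visit-time))
        (λ i j → eval-value h (position (A i)) (direction (A i)) (ρ i) j)
        (λ i j → trans (eval-value h (position (A (cyc i))) (direction (A (cyc i))) (ρ (cyc i)) j)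
          (sym (code-agree h {position (A i)} {direction (A i)} {_} {_} {ρ (cyc i)} (arrival i) j))))

      same-position : position (A zero) ≡ position (A last)
      -- The last and first edges share the vertex in part `ρ zero`, so equal directions force equal
      -- positions.
      same-position = sym (code-same-direction {p = ρ zero} (sym same-direction)
        (subst (λ k → F (A last) (ρ k) ≡ F (A k) (ρ k)) (cyc-fromℕ (suc m)) (arrival last)))

    module _ {n : ℕ} .{{_ : NonZero r}} {p₀ p₁ : Fin r} (p₀≢p₁ : p₀ ≢ p₁)
      (fits : (V ^ J) ^ t * r ≤ n) where

      rainbow-free : ∃[ H ] (Linear {r} {n} H × numEdges H ≡ #edges ×
        (∀ m → suc m ≤ l → ¬ RainbowCycle H (suc m)))
      rainbow-free =
        hypergraph F fits p₀≢p₁ F-separated , hypergraph-linear F fits p₀≢p₁ F-separated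
        , numEdges-hypergraph F fits p₀≢p₁ F-separated
        , λ m m<l cycle →
            let ρ , A , ρ-inj , A-inj , arrival = rainbow-cycle-codes F fits p₀≢p₁ F-separated cycle
            in no-rainbow-cycle m<l ρ A ρ-inj A-inj arrival

  sparse-hypergraph : ∀ {n} .{{_ : NonZero r}} {p₀ p₁ : Fin r} → p₀ ≢ p₁ → (V ^ J) ^ t * r ≤ n →
    ∃[ s ] ((K ^ J′) ^ t ≤ Q ^ (suc l ^ r) * s × ∃[ H ] (Linear {r} {n} H ×
      numEdges H ≡ (K ^ J) ^ t * s × (∀ m → suc m ≤ l → ¬ RainbowCycle H (suc m))))
  sparse-hypergraph p₀≢p₁ fits =
    let s , ι , ι-injective , equal-norms , enough = pigeonhole-class norms
    in s , enough , Edges.rainbow-free ι ι-injective equal-norms p₀≢p₁ fits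

-- Growth estimates

^-distribʳ-* : ∀ a b n → (a * b) ^ n ≡ a ^ n * b ^ n
^-distribʳ-* a b zero    = refl
^-distribʳ-* a b (suc n) rewrite ^-distribʳ-* a b n = swap-middle a b (a ^ n) (b ^ n)
  where
  swap-middle : ∀ a b x y → a * b * (x * y) ≡ a * x * (b * y)
  swap-middle = solve-∀

m≤m^n : ∀ m n .{{_ : NonZero n}} → m ≤ m ^ n
m≤m^n zero      n       = z≤n
m≤m^n m@(suc _) (suc n) = m≤m*n m (m ^ n) {{m^n≢0 m n}}

-- A discrete mean value inequality. The induction splits off one factor `suc m` as 1 + m and uses
-- m(m + 1)ⁿ ≤ (m + 1)ⁿ⁺¹.
[1+m]^[1+n]≤ : ∀ m n → suc m ^ suc n ≤ m ^ suc n + suc n * suc m ^ n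
[1+m]^[1+n]≤ m zero    = ≤-reflexive (expand m)
  where
  expand : ∀ m → suc m * 1 ≡ m * 1 + 1 * 1
  expand = solve-∀
[1+m]^[1+n]≤ m (suc n) = begin
  suc m ^ suc n + m * suc m ^ suc n
    ≤⟨ +-monoʳ-≤ (suc m ^ suc n) (*-monoʳ-≤ m ([1+m]^[1+n]≤ m n)) ⟩
  suc m ^ suc n + m * (m ^ suc n + suc n * suc m ^ n)
    ≤⟨ +-monoʳ-≤ (suc m ^ suc n) (begin
         m * (m ^ suc n + suc n * suc m ^ n)          ≡⟨ expand m (m ^ suc n) (suc n) (suc m ^ n) ⟩
         m * m ^ suc n + suc n * (m * suc m ^ n)
           ≤⟨ +-monoʳ-≤ (m * m ^ suc n) (*-monoʳ-≤ (suc n) (m≤n+m (m * suc m ^ n) (suc m ^ n))) ⟩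
         m * m ^ suc n + suc n * suc m ^ suc n        ∎) ⟩
  suc m ^ suc n + (m * m ^ suc n + suc n * suc m ^ suc n)
    ≡⟨ shuffle (suc m ^ suc n) (m * m ^ suc n) _ ⟩
  m * m ^ suc n + suc (suc n) * suc m ^ suc n ∎
  where
  open ≤-Reasoning
  expand : ∀ m a b c → m * (a + b * c) ≡ m * a + b * (m * c)
  expand = solve-∀
  shuffle : ∀ a b c → a + (b + c) ≡ b + (a + c)
  shuffle = solve-∀

-- Subtraction-free form of: the boundary [0, T]^r ∖ [0, T)^r for T = k r is
-- less than a k-th of the grid [0, T]^r.
grid-boundary : ∀ k r .{{_ : NonZero r}} →
  suc (k * r) ^ r * k + 1 ≤ (k * r) ^ r * k + suc (k * r) ^ r
grid-boundary k r@(suc r′) = begin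
  suc T ^ r * k + 1
    ≤⟨ +-mono-≤ (*-monoˡ-≤ k ([1+m]^[1+n]≤ T r′)) (m^n>0 (suc T) r′) ⟩
  (T ^ r + r * suc T ^ r′) * k + suc T ^ r′
    -- With `T = k * r` the error terms add up to `suc T * suc T ^ r′`, which is exactly
    -- `suc T ^ r`.
    ≡⟨ regroup (T ^ r) r (suc T ^ r′) k ⟩
  T ^ r * k + suc T ^ r ∎
  where
  open ≤-Reasoning
  T = k * r
  regroup : ∀ a r b k → (a + r * b) * k + b ≡ a * k + (b + k * r * b)
  regroup = solve-∀

-- An upward search from `K₀`, of length bounded by `f`, stops at the first `K` whose successor
-- overshoots `n`.
bracket : ∀ (g : ℕ → ℕ) n f K₀ → g K₀ ≤ n → n < g (f + K₀) →
  ∃[ K ] (K₀ ≤ K × g K ≤ n × n < g (suc K))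
bracket g n zero    K₀ g≤n n<g = ⊥-elim (<⇒≱ n<g g≤n)
bracket g n (suc f) K₀ g≤n n<g with ≤-<-connex (g (suc K₀)) n
... | inj₂ n<g₁ = K₀ , ≤-refl , g≤n , n<g₁
... | inj₁ g₁≤n
  with K , K₀<K , found ← bracket g n f (suc K₀) g₁≤n (subst (λ x → n < g x) (sym (+-suc f K₀)) n<g)
  = K , <⇒≤ K₀<K , found

-- The exponent hypothesis amounts to Gp + ck + 1 ≤ (G + G′)k. The spare power of `K` absorbs the
-- constants, and both sides are multiplied by (q K^c)^k to avoid dividing.
edge-count : ∀ {n k p K G G′ C s a q c} .{{_ : NonZero K}} → p + 1 ≡ 2 * k →
  n ≤ a * K ^ G → K ^ G′ ≤ C * s → C ≤ q * K ^ c →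
  G * k + c * k + 1 ≤ G′ * k + G → a ^ p * q ^ k < K →
  n ^ p < (K ^ G * s) ^ k
edge-count {n} {k} {p} {K} {G} {G′} {C} {s} {a} {q} {c} p+1≡2k n≤ K^G′≤ C≤ exponents const<K =
  *-cancelʳ-< ((q * K ^ c) ^ k) _ _ (begin-strict
    n ^ p * (q * K ^ c) ^ k
      ≤⟨ *-monoˡ-≤ _ (^-monoˡ-≤ p n≤) ⟩
    (a * K ^ G) ^ p * (q * K ^ c) ^ k
      ≡⟨ cong₂ _*_ (^-distribʳ-* a (K ^ G) p) (^-distribʳ-* q (K ^ c) k) ⟩
    (a ^ p * (K ^ G) ^ p) * (q ^ k * (K ^ c) ^ k)
      ≡⟨ regroup (a ^ p) _ (q ^ k) _ ⟩
    (a ^ p * q ^ k) * ((K ^ G) ^ p * (K ^ c) ^ k)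
      ≡⟨ cong (λ x → (a ^ p * q ^ k) * x)
           (trans (cong₂ _*_ (^-*-assoc K G p) (^-*-assoc K c k)) (sym (^-distribˡ-+-* K (G * p) (c * k)))) ⟩
    (a ^ p * q ^ k) * K ^ (G * p + c * k)
      <⟨ *-monoˡ-< (K ^ (G * p + c * k)) {{m^n≢0 K (G * p + c * k)}} const<K ⟩
    K ^ suc (G * p + c * k)
      ≤⟨ ^-monoʳ-≤ K exponents′ ⟩
    K ^ ((G + G′) * k)
      ≡⟨ trans (sym (^-*-assoc K (G + G′) k)) (cong (_^ k) (^-distribˡ-+-* K G G′)) ⟩
    (K ^ G * K ^ G′) ^ k
      ≤⟨ ^-monoˡ-≤ k (*-monoʳ-≤ (K ^ G) (≤-trans K^G′≤ (*-monoˡ-≤ s C≤))) ⟩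
    (K ^ G * (q * K ^ c * s)) ^ k
      ≡⟨ cong (_^ k) (regroup′ (K ^ G) (q * K ^ c) s) ⟩
    (K ^ G * s * (q * K ^ c)) ^ k
      ≡⟨ ^-distribʳ-* (K ^ G * s) (q * K ^ c) k ⟩
    (K ^ G * s) ^ k * (q * K ^ c) ^ k ∎)
  where
  open ≤-Reasoning
  regroup : ∀ a b c d → (a * b) * (c * d) ≡ (a * c) * (b * d)
  regroup = solve-∀
  regroup′ : ∀ a b c → a * (b * c) ≡ a * c * b
  regroup′ = solve-∀
  collect : ∀ G p x → suc (G * p + x) + G ≡ G * (p + 1) + x + 1
  collect = solve-∀
  double : ∀ G k x → G * (2 * k) + x + 1 ≡ G * k + (G * k + x + 1)
  double = solve-∀
  collect′ : ∀ G G′ k → G * k + (G′ * k + G) ≡ (G + G′) * k + G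
  collect′ = solve-∀

  exponents′ : suc (G * p + c * k) ≤ (G + G′) * k
  exponents′ = +-cancelʳ-≤ G _ _ (begin
    suc (G * p + c * k) + G           ≡⟨ collect G p (c * k) ⟩
    G * (p + 1) + c * k + 1           ≡⟨ cong (λ x → G * x + c * k + 1) p+1≡2k ⟩
    G * (2 * k) + c * k + 1           ≡⟨ double G k (c * k) ⟩
    G * k + (G * k + c * k + 1)       ≤⟨ +-monoʳ-≤ (G * k) exponents ⟩
    G * k + (G′ * k + G)              ≡⟨ collect′ G G′ k ⟩
    (G + G′) * k + G                  ∎)

-- Choice of parameters and conclusion

module Parameters (r : ℕ) (3≤r : 3 ≤ r) (k : ℕ) (1≤k : 1 ≤ k) where

  instance
    r≢0 : NonZero r
    r≢0 = >-nonZero (≤-trans (s≤s z≤n) 3≤r)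

    k≢0 : NonZero k
    k≢0 = >-nonZero 1≤k

  -- Norms are O(K ^ c) and there are 4 ^ r rankings, so restricting to one class
  -- costs a factor O(K ^ (c * 4 ^ r)); t is chosen to outweigh its k-th power.
  T J J′ c t G G′ p q a K₀ : ℕ
  T  = k * r
  J  = suc T ^ r
  J′ = T ^ r
  -- Twice E + 1: norms are quadratic in values of size at most J′ K^(E + 1).
  c  = suc (r * (T * suc T ^ (4 * r))) + suc (r * (T * suc T ^ (4 * r)))
  t  = suc (c * 4 ^ r * k)
  G  = J * t
  G′ = J′ * t
  p  = 2 * k ∸ 1
  q  = suc (t * (J′ * J′)) ^ (4 ^ r)
  a  = (suc J′ * 2) ^ G * r
  -- Ensures both `2 ≤ K` and `a ^ p * q ^ k < K` for every `K` from `K₀` on.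
  K₀ = 2 + a ^ p * q ^ k

  #vertices : ℕ → ℕ
  #vertices K = ((suc J′ * K) ^ J) ^ t * r

  N : ℕ
  N = #vertices K₀

  -- Guarantees that the search for `K` ends.
  n≤#vertices : ∀ n → n ≤ #vertices n
  n≤#vertices n = begin
    n                             ≤⟨ m≤n*m n (suc J′) ⟩
    suc J′ * n                    ≤⟨ m≤m^n (suc J′ * n) J {{m^n≢0 (suc T) r}} ⟩
    (suc J′ * n) ^ J              ≤⟨ m≤m^n _ t ⟩
    ((suc J′ * n) ^ J) ^ t        ≤⟨ m≤m*n _ r ⟩
    ((suc J′ * n) ^ J) ^ t * r    ∎
    where open ≤-Reasoning

  -- As K + 1 ≤ 2K, rounding `n` down to an available vertex count costs only a constant factor.
  #vertices-suc≤ : ∀ K .{{_ : NonZero K}} → #vertices (suc K) ≤ a * K ^ G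
  #vertices-suc≤ K = begin
    ((suc J′ * suc K) ^ J) ^ t * r
      ≡⟨ cong (_* r) (^-*-assoc (suc J′ * suc K) J t) ⟩
    (suc J′ * suc K) ^ G * r
      ≤⟨ *-monoˡ-≤ r (^-monoˡ-≤ G (*-monoʳ-≤ (suc J′) (+-monoˡ-≤ K (>-nonZero⁻¹ K)))) ⟩
    (suc J′ * (K + K)) ^ G * r
      ≡⟨ cong (λ x → x ^ G * r) (double (suc J′) K) ⟩
    (suc J′ * 2 * K) ^ G * r
      ≡⟨ cong (_* r) (^-distribʳ-* (suc J′ * 2) K G) ⟩
    (suc J′ * 2) ^ G * K ^ G * r
      ≡⟨ regroup ((suc J′ * 2) ^ G) (K ^ G) r ⟩
    a * K ^ G ∎
    where
    open ≤-Reasoning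
    double : ∀ x K → x * (K + K) ≡ x * 2 * K
    double = solve-∀
    regroup : ∀ x y r → x * y * r ≡ x * r * y
    regroup = solve-∀

  -- Since t = 1 + c 4^r k, the left side is exactly (Jk + 1)t, and `grid-boundary` multiplied by
  -- `t` applies.
  exponents : G * k + c * 4 ^ r * k + 1 ≤ G′ * k + G
  exponents = begin
    G * k + c * 4 ^ r * k + 1       ≡⟨ collect J t k (c * 4 ^ r * k) ⟩
    J * k * t + t                   ≡⟨ factor (J * k) t ⟩
    (J * k + 1) * t                 ≤⟨ *-monoˡ-≤ t (grid-boundary k r) ⟩
    (J′ * k + J) * t                ≡⟨ expand J′ k J t ⟩
    G′ * k + G                      ∎
    where
    open ≤-Reasoning
    collect : ∀ J t k x → J * t * k + x + 1 ≡ J * k * t + suc x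
    collect = solve-∀
    factor : ∀ x t → x * t + t ≡ (x + 1) * t
    factor = solve-∀
    expand : ∀ J′ k J t → (J′ * k + J) * t ≡ J′ * t * k + J * t
    expand = solve-∀

  p+1≡2k : p + 1 ≡ 2 * k
  p+1≡2k = m∸n+n≡m {2 * k} {1} (≤-trans 1≤k (m≤m+n k (k + 0)))

  colours≤ : ∀ K .{{_ : NonZero K}} (1≤T : 1 ≤ T) (2≤K : 2 ≤ K) →
    Construction.Q r T t K 3 1≤T 2≤K ^ (4 ^ r) ≤ q * K ^ (c * 4 ^ r)
  colours≤ K 1≤T 2≤K = begin
    suc (t * (J′ * K ^ e * (J′ * K ^ e))) ^ (4 ^ r)
      ≡⟨ cong (λ x → suc x ^ (4 ^ r)) (regroup t J′ (K ^ e)) ⟩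
    suc (t * (J′ * J′) * (K ^ e * K ^ e)) ^ (4 ^ r)
      ≡⟨ cong (λ x → suc (t * (J′ * J′) * x) ^ (4 ^ r)) (^-distribˡ-+-* K e e) ⟨
    suc (t * (J′ * J′) * K ^ c) ^ (4 ^ r)
      ≤⟨ ^-monoˡ-≤ (4 ^ r) (+-monoˡ-≤ (t * (J′ * J′) * K ^ c) (m^n>0 K c)) ⟩
    (suc (t * (J′ * J′)) * K ^ c) ^ (4 ^ r)
      ≡⟨ ^-distribʳ-* (suc (t * (J′ * J′))) (K ^ c) (4 ^ r) ⟩
    q * (K ^ c) ^ (4 ^ r)
      ≡⟨ cong (q *_) (^-*-assoc K c (4 ^ r)) ⟩
    q * K ^ (c * 4 ^ r) ∎
    where
    open ≤-Reasoning
    e = suc (r * (T * suc T ^ (4 * r)))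
    regroup : ∀ t x y → t * (x * y * (x * y)) ≡ t * (x * x) * (y * y)
    regroup = solve-∀

  LargeRainbowFree : ℕ → Set
  LargeRainbowFree n =
    ∃[ H ] (Linear {r} {n} H × n ^ p < numEdges H ^ k × ¬ RainbowCycle H 2 × ¬ RainbowCycle H 3)

  construction : ∀ n K → K₀ ≤ K → #vertices K ≤ n → n < #vertices (suc K) → LargeRainbowFree n
  construction n K K₀≤K fits maximal =
    -- The value `l = 3` allows four visit times, as needed for cycles of length up to four.
    conclude (Construction.sparse-hypergraph r T t K 3 1≤T 2≤K (proj₂ (proj₂ (two-parts 3≤r))) fits)
    where
    two-parts : 3 ≤ r → Σ (Fin r) λ p₀ → Σ (Fin r) λ p₁ → p₀ ≢ p₁
    two-parts (s≤s (s≤s _)) = zero , suc zero , λ ()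

    2≤K : 2 ≤ K
    2≤K = m+n≤o⇒m≤o 2 K₀≤K

    instance
      K≢0 : NonZero K
      K≢0 = >-nonZero (<⇒≤ 2≤K)

    1≤T : 1 ≤ T
    1≤T = >-nonZero⁻¹ T {{m*n≢0 k r}}

    conclude : _ → LargeRainbowFree n
    conclude (s , enough , H , linear , #edges , no-cycle) =
      H , linear
      , subst (λ e → n ^ p < e ^ k) (sym (trans #edges (cong (_* s) (^-*-assoc K J t))))
          (edge-count {k = k} {p} {K} {G} {G′} {a = a} {q} {c * 4 ^ r} p+1≡2k
            (≤-trans (<⇒≤ maximal) (#vertices-suc≤ K))
            (≤-trans (≤-reflexive (sym (^-*-assoc K J′ t))) enough)
            (colours≤ K 1≤T 2≤K)
            exponents
            (m+n≤o⇒n≤o 1 K₀≤K))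
      , no-cycle 1 (s≤s (s≤s z≤n)) , no-cycle 2 ≤-refl

  eventually : ∀ n → N ≤ n → LargeRainbowFree n
  eventually n N≤n =
    let K , K₀≤K , fits , maximal =
          bracket #vertices n (suc n) K₀ N≤n (≤-trans (m≤m+n (suc n) K₀) (n≤#vertices (suc n + K₀)))
    in construction n K K₀≤K fits maximal

-- Taking k-th roots gives |H| > n^(2 - 1/k) from some `N` depending on `k` on; letting `k` grow
-- slowly with `n` gives n^(2 - o(1)).
theorem4 : (r : ℕ) → 3 ≤ r → (k : ℕ) → 1 ≤ k →
    ∃[ N ] ((n : ℕ) → N ≤ n →
    ∃[ H ] (Linear {r} {n} H ×
    n ^ (2 * k ∸ 1) < numEdges H ^ k ×
    ¬ RainbowCycle H 2 ×
    ¬ RainbowCycle H 3))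
theorem4 r 3≤r k 1≤k = N , eventually
  where open Parameters r 3≤r k 1≤k
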